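{- Let $q$ be a positive integer and let $\mathcal{H}$ be a $q$-uniform (possibly infinite) hypergraph that satisfies the fractional Helly property. If $\mathcal{H}$ has arbitrarily large finite independent sets (that is, for every $n\in\mathbb{N}$ there is a finite independent set of $\mathcal{H}$ of size at least $n$), then $\mathcal{H}$ has an infinite independent set.
   Context: A $q$-uniform hypergraph $\mathcal{H}$ consists of a (possibly infinite) vertex set $V(\mathcal{H})$ and a collection of $q$-element subsets of $V(\mathcal{H})$, called edges. For $S\subset V(\mathcal{H})$, $\mathcal{H}[S]$ is the subhypergraph consisting of the edges contained in $S$, and $e(\cdot)$ denotes the number of edges. A set of vertices is independent if it contains no edge. A set of vertices is a ($q$-uniform) clique if all of its $q$-element subsets are edges. $\mathcal{H}$ satisfies the fractional Helly property if for every $\alpha>0$ there exists $\beta>0$ such that, for every finite $S\subset V(\mathcal{H})$ with $e(\mathcal{H}[S])\ge \alpha\binom{|S|}{q}$, there exists a clique of $\mathcal{H}[S]$ of size at least $\beta|S|$. -}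

module Defs where

open import Data.Integer.Base using (+_)
open import Data.List.Base using (List; []; _∷_; _++_; filter; length; map)
open import Data.List.Membership.Propositional using (_∈_)
open import Data.List.Relation.Binary.Permutation.Propositional using (_↭_)
open import Data.List.Relation.Unary.All using (All)
open import Data.List.Relation.Unary.Unique.Propositional using (Unique)
open import Data.Nat.Base using (ℕ; zero; suc; _≤_)
open import Data.Nat.Combinatorics using (_C_)
open import Data.Product.Base using (∃; _×_)
open import Data.Rational.Base as ℚ using (ℚ; 0ℚ)
open import Data.Rational.Literals using (fromℤ)
open import Level using (Level; _⊔_) renaming (suc to lsuc)
open import Relation.Binary.PropositionalEquality.Core using (_≡_)
open import Relation.Nullary.Negation.Core using (¬_)
open import Relation.Unary using (Pred; Decidable; _⊆_)

-- A finite set is represented by a duplicate-free list, two such lists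
-- being the same set when they are permutations of each other. Thus
-- `Edge xs` says that xs lists the elements of an edge, in some order.

record Hypergraph (q : ℕ) (v e : Level) : Set (lsuc (v ⊔ e)) where
  field
    Vertex      : Set v
    Edge        : Pred (List Vertex) e
    edge-unique : ∀ {xs} → Edge xs → Unique xs
    edge-size   : ∀ {xs} → Edge xs → length xs ≡ q
    edge-resp-↭ : ∀ {xs ys} → xs ↭ ys → Edge xs → Edge ys

-- For duplicate-free xs, `choose k xs` lists each k-element subset of xs
-- exactly once, as the subsequence of xs with those elements.

choose : ∀ {a} {A : Set a} → ℕ → List A → List (List A)
choose zero    xs       = [] ∷ []
choose (suc k) []       = []
choose (suc k) (x ∷ xs) = map (x ∷_) (choose k xs) ++ choose (suc k) xs

Infinite : ∀ {a p} {A : Set a} → Pred A p → Set (a ⊔ p)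
Infinite P = ¬ ∃ λ xs → P ⊆ (_∈ xs)

module _ {q : ℕ} {v e : Level} (H : Hypergraph q v e) where
  open Hypergraph H

  Independent : ∀ {p} → Pred Vertex p → Set (v ⊔ e ⊔ p)
  Independent P = ∀ {xs} → Edge xs → ¬ All P xs

  Clique : ∀ {p} → Pred Vertex p → Set (v ⊔ e ⊔ p)
  Clique P = ∀ {xs} → Unique xs → length xs ≡ q → All P xs → Edge xs

  -- The number of edges of the subhypergraph induced on S.
  edgeCount : Decidable Edge → List Vertex → ℕ
  edgeCount edge? S = length (filter edge? (choose q S))

  -- α and β range over the positive rationals. This is equivalent to
  -- letting them range over the positive reals, because the condition for
  -- α and β implies the one for any larger α and any smaller β.
  FractionalHelly : Decidable Edge → Set (v ⊔ e)
  FractionalHelly edge? =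
    ∀ (α : ℚ) → 0ℚ ℚ.< α →
    ∃ λ (β : ℚ) → 0ℚ ℚ.< β ×
      (∀ (S : List Vertex) → Unique S →
       fromℤ (+ edgeCount edge? S) ℚ.≥ α ℚ.* fromℤ (+ (length S C q)) →
       ∃ λ (K : List Vertex) →
         Unique K × (_∈ K) ⊆ (_∈ S) × Clique (_∈ K) ×
         fromℤ (+ length K) ℚ.≥ β ℚ.* fromℤ (+ length S))

  ArbitrarilyLargeFiniteIndependentSets : Set (v ⊔ e)
  ArbitrarilyLargeFiniteIndependentSets =
    ∀ (n : ℕ) → ∃ λ (S : List Vertex) →
      Unique S × n ≤ length S × Independent (_∈ S)

  HasInfiniteIndependentSet : Set (lsuc v ⊔ e)
  HasInfiniteIndependentSet =
    ∃ λ (I : Pred Vertex v) → Infinite I × Independent I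

{-# OPTIONS --safe #-}
-- Call a vertex set Y big if it contains arbitrarily large finite independent
-- sets. Bigness is partition regular, so "for all y in Y outside a set that is
-- not big" behaves like a quantifier. Some big Z decides, in the sense of the
-- q-fold iterate of this quantifier, whether its q-tuples are edges.
--
-- If almost all tuples are non-edges, an infinite independent set is built
-- greedily. If almost all are edges, one finds q disjoint independent sets of
-- size t whose transversals are all edges. Their union S has at least t^q edges,
-- which is the fraction q^(-q) of (qt)^q ≥ |S| C q, so fractional Helly gives a
-- clique of size β q t. But a clique has fewer than q vertices in each of the q
-- independent parts, which is absurd once t > q / β.

module Submission where

open import Defs
open import Axiom.ExcludedMiddle using (ExcludedMiddle)
open import Data.Nat.Base using (ℕ; NonZero)

open import Data.Empty using (⊥-elim)
open import Data.Integer.Base as ℤ using (+[1+_]; -[1+_])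
import Data.Integer.Properties as ℤₚ
open import Data.List.Base
  using (List; []; _∷_; _++_; cartesianProductWith; concat; filter; length; map; replicate; take)
open import Data.List.Membership.Propositional using (_∈_; _∉_)
open import Data.List.Membership.Propositional.Properties
  using (∈-++⁺ˡ; ∈-++⁺ʳ; ∈-++⁻; ∈-∃++; ∈-cartesianProductWith⁺; ∈-cartesianProductWith⁻;
         ∈-filter⁻)
open import Data.List.Properties using (length-++; length-map; length-take; filter-all)
open import Data.List.Relation.Binary.Permutation.Propositional
  using (_↭_; ↭-refl; ↭-trans; ↭-sym; prep; ↭⇒↭ₛ)
open import Data.List.Relation.Binary.Permutation.Propositional.Properties
  using (shift; ↭-length; ∈-resp-↭)
import Data.List.Relation.Binary.Permutation.Setoid.Properties as SetoidPerm
open import Data.List.Relation.Binary.Sublist.Propositional as Sub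
  using ([]; _∷_; _∷ʳ_; minimum) renaming (_⊆_ to _⊑_)
import Data.List.Relation.Binary.Sublist.Propositional.Properties as Sub
open import Data.List.Relation.Binary.Subset.Propositional.Properties using (⊆∷∧∉⇒⊆)
open import Data.List.Relation.Unary.All as All using (All; []; _∷_)
open import Data.List.Relation.Unary.All.Properties using (¬Any⇒All¬)
open import Data.List.Relation.Unary.AllPairs using ([]; _∷_)
open import Data.List.Relation.Unary.Any using (here; there)
open import Data.List.Relation.Unary.Unique.Propositional using (Unique)
import Data.List.Relation.Unary.Unique.Propositional.Properties as Unique
open import Data.Nat.Base using (zero; suc; _+_; _*_; _∸_; _^_; _≤_; _<_; z≤n; s≤s; pred;
         _≤′_; ≤′-refl; ≤′-step)
open import Data.Nat.Combinatorics using (_C_; nCk+nC[k+1]≡[n+1]C[k+1]; k>n⇒nCk≡0)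
open import Data.Nat.Coprimality using (Coprime; 1-coprimeTo)
open import Data.Nat.Properties
open import Data.Product.Base using (∃; _×_; _,_; proj₁; proj₂)
open import Data.Rational.Base as ℚ using (ℚ; mkℚ; toℚᵘ)
open import Data.Rational.Literals using (fromℤ)
import Data.Rational.Properties as ℚₚ
open import Data.Rational.Unnormalised.Base as ℚᵘ using (mkℚᵘ; *≤*)
import Data.Rational.Unnormalised.Properties as ℚᵘₚ
open import Data.Sum.Base as Sum using (_⊎_; inj₁; inj₂; [_,_]′)
open import Data.Unit.Base using (⊤)
open import Function.Base using (_∘_; id)
open import Level using (Level; _⊔_; Lift; lift; lower) renaming (suc to lsuc)
open import Relation.Binary.PropositionalEquality
  using (_≡_; refl; sym; trans; cong; cong₂; subst; subst₂; setoid)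
open import Relation.Nullary using (yes; no; ¬_; ¬?)
open import Relation.Nullary.Decidable using (decidable-stable)
open import Relation.Unary using (Pred; Decidable; _⊆_; _∩_; _∪_; ∁)

-- Tuples and subsets of lists

module _ {a} {A : Set a} where

  transversals : List (List A) → List (List A)
  transversals []         = [] ∷ []
  transversals (xs ∷ xss) = cartesianProductWith _∷_ xs (transversals xss)

  ∈-transversals-replicate : ∀ {F xs} → All (_∈ F) xs → xs ∈ transversals (replicate (length xs) F)
  ∈-transversals-replicate []           = here refl
  ∈-transversals-replicate (x∈F ∷ xs⊆F) =
    ∈-cartesianProductWith⁺ _∷_ x∈F (∈-transversals-replicate xs⊆F)

  choose-mono-++ʳ : ∀ k (xs : List A) {ys} → choose k ys ⊑ choose k (xs ++ ys)
  choose-mono-++ʳ zero    xs       = Sub.⊆-refl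
  choose-mono-++ʳ (suc k) []       = Sub.⊆-refl
  choose-mono-++ʳ (suc k) (x ∷ xs) = Sub.++⁺ˡ _ (choose-mono-++ʳ (suc k) xs)

  -- Both lists split alike at a vertex y of the first part: entries through y come first, then the
  -- others. A sublist, unlike an inclusion, compares lengths directly.
  transversals⊑choose : ∀ xss → transversals xss ⊑ choose (length xss) (concat xss)
  transversals⊑choose []         = Sub.⊆-refl
  transversals⊑choose (xs ∷ xss) = go xs
    where
    go : ∀ ys → cartesianProductWith _∷_ ys (transversals xss) ⊑
                choose (suc (length xss)) (ys ++ concat xss)
    go []       = minimum _
    go (y ∷ ys) = Sub.++⁺
      (Sub.map⁺ (y ∷_) (Sub.⊆-trans (transversals⊑choose xss) (choose-mono-++ʳ (length xss) ys {concat xss})))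
      (go ys)

  length-cartesianProductWith : ∀ {b c} {B : Set b} {C : Set c} (f : A → B → C) xs ys →
    length (cartesianProductWith f xs ys) ≡ length xs * length ys
  length-cartesianProductWith f []       ys = refl
  length-cartesianProductWith f (x ∷ xs) ys = trans (length-++ (map (f x) ys))
    (cong₂ _+_ (length-map (f x) ys) (length-cartesianProductWith f xs ys))

  length-transversals : ∀ {t xss} → All (λ xs → length xs ≡ t) xss →
    length (transversals xss) ≡ t ^ length xss
  length-transversals []                           = refl
  length-transversals {xss = xs ∷ xss} (refl ∷ eqs) =
    trans (length-cartesianProductWith _∷_ xs (transversals xss))
          (cong (length xs *_) (length-transversals eqs))

  length-concat : ∀ {t} {xss : List (List A)} → All (λ xs → length xs ≡ t) xss →
    length (concat xss) ≡ length xss * t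
  length-concat []                            = refl
  length-concat {xss = xs ∷ xss} (refl ∷ eqs) =
    trans (length-++ xs) (cong (length xs +_) (length-concat eqs))

  length-filter-∁ : ∀ {p} {P : Pred A p} (P? : Decidable P) xs →
    length (filter P? xs) + length (filter (¬? ∘ P?) xs) ≡ length xs
  length-filter-∁ P? []       = refl
  length-filter-∁ P? (x ∷ xs) with P? x
  ... | yes _ = cong suc (length-filter-∁ P? xs)
  ... | no  _ = trans (+-suc _ _) (cong suc (length-filter-∁ P? xs))

  ≤-length-take : ∀ {n} {xs : List A} → n ≤ length xs → length (take n xs) ≡ n
  ≤-length-take {n} {xs} n≤ = trans (length-take n xs) (m≤n⇒m⊓n≡m n≤)

  ∈-take⁻ : ∀ n {xs : List A} → (_∈ take n xs) ⊆ (_∈ xs)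
  ∈-take⁻ n {xs} = Sub.lookup (Sub.take-⊆ n xs)

  extract : ∀ {x : A} {xs} → x ∈ xs → ∃ λ ys → xs ↭ x ∷ ys
  extract x∈xs with ys , zs , refl ← ∈-∃++ x∈xs = ys ++ zs , shift _ ys zs

  module _ (F : ℕ → List A) (step : ∀ n → (_∈ F n) ⊆ (_∈ F (suc n))) where

    ascending : ∀ {m n} → m ≤ n → (_∈ F m) ⊆ (_∈ F n)
    ascending = go ∘ ≤⇒≤′
      where
      go : ∀ {m n} → m ≤′ n → (_∈ F m) ⊆ (_∈ F n)
      go ≤′-refl       = id
      go (≤′-step m≤n) = step _ ∘ go m≤n

    ascending-All : ∀ {xs} → All (λ x → ∃ λ n → x ∈ F n) xs → ∃ λ n → All (_∈ F n) xs
    ascending-All []                = 0 , []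
    ascending-All ((m , x∈Fm) ∷ ps) with n , xs⊆Fn ← ascending-All ps =
      m + n , ascending (m≤m+n m n) x∈Fm ∷ All.map (ascending (m≤n+m n m)) xs⊆Fn

-- Duplicate-free lists as finite sets

module _ (em : ∀ {ℓ} → ExcludedMiddle ℓ) {a} {A : Set a} where

  -- Walk along F and pull each entry that occurs in xs out of it. Edges may list their vertices in
  -- any order, while homogeneity below speaks of sublists.
  reorder : ∀ {xs : List A} F → Unique xs → (_∈ xs) ⊆ (_∈ F) → ∃ λ ys → ys ⊑ F × xs ↭ ys
  reorder {[]}     []      u xs⊆F = [] , [] , ↭-refl
  reorder {x ∷ xs} []      u xs⊆F with () ← xs⊆F (here refl)
  reorder {xs}     (f ∷ F) u xs⊆F with em {P = f ∈ xs}
  ... | no f∉xs with ys , ys⊑F , xs↭ys ← reorder F u (⊆∷∧∉⇒⊆ xs⊆F f∉xs) = ys , f ∷ʳ ys⊑F , xs↭ys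
  ... | yes f∈xs with zs , xs↭f∷zs ← extract f∈xs
                 with u′@(_ ∷ zs-unique) ← SetoidPerm.Unique-resp-↭ (setoid A) (↭⇒↭ₛ xs↭f∷zs) u
                 with ys , ys⊑F , zs↭ys ← reorder F zs-unique
                        (⊆∷∧∉⇒⊆ (λ z∈zs → xs⊆F (∈-resp-↭ (↭-sym xs↭f∷zs) (there z∈zs)))
                                (Unique.Unique[x∷xs]⇒x∉xs u′)) =
      f ∷ ys , refl ∷ ys⊑F , ↭-trans xs↭f∷zs (prep f zs↭ys)

  Unique⇒length≤ : ∀ {xs F : List A} → Unique xs → (_∈ xs) ⊆ (_∈ F) → length xs ≤ length F
  Unique⇒length≤ {F = F} u xs⊆F with ys , ys⊑F , xs↭ys ← reorder F u xs⊆F =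
    ≤-trans (≤-reflexive (↭-length xs↭ys)) (Sub.length-mono-≤ ys⊑F)

-- Big vertex sets

module Largeness (em : ∀ {ℓ} → ExcludedMiddle ℓ) {q : ℕ} {v e : Level} (H : Hypergraph q v e) where
  open Hypergraph H

  ℓ : Level
  ℓ = v ⊔ e

  Independent-⊆ : ∀ {S T} → (_∈ T) ⊆ (_∈ S) → Independent H (_∈ S) → Independent H (_∈ T)
  Independent-⊆ T⊆S ind edge xs⊆T = ind edge (All.map T⊆S xs⊆T)

  Big : ∀ {p} → Pred Vertex p → Set (ℓ ⊔ p)
  Big Y = ∀ n → ∃ λ S → Unique S × n ≤ length S × Independent H (_∈ S) × (_∈ S) ⊆ Y

  Big-mono : ∀ {p r} {Y : Pred Vertex p} {Z : Pred Vertex r} → Y ⊆ Z → Big Y → Big Z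
  Big-mono Y⊆Z big n with S , u , n≤ , ind , S⊆Y ← big n = S , u , n≤ , ind , λ x∈S → Y⊆Z (S⊆Y x∈S)

  Big-∈ : ∀ {p} {Y : Pred Vertex p} → Big Y → ∃ Y
  Big-∈ big with x ∷ _ , _ , _ , _ , S⊆Y ← big 1 = x , S⊆Y (here refl)

  ¬Big-finite : ∀ F → ¬ Big (_∈ F)
  ¬Big-finite F big with S , u , n≤ , _ , S⊆F ← big (suc (length F)) =
    <⇒≱ n≤ (Unique⇒length≤ em u S⊆F)

  module _ {p r} {Y : Pred Vertex p} {φ : Pred Vertex r} where

    -- If `Y ∩ φ` has no independent set of size n, then an independent set of size n + m in Y has
    -- at least m vertices outside φ, for every m.
    Big-partition : Big Y → ¬ Big (Y ∩ ∁ φ) → Big (Y ∩ φ)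
    Big-partition big ¬big n
      with em {P = ∃ λ S → Unique S × n ≤ length S × Independent H (_∈ S) × (_∈ S) ⊆ (Y ∩ φ)}
    ... | yes S = S
    ... | no ¬S = ⊥-elim (¬big ∁φ-big)
      where
      φ? : Decidable φ
      φ? _ = em

      ∁φ-big : Big (Y ∩ ∁ φ)
      ∁φ-big m with S , u , n+m≤ , ind , S⊆Y ← big (n + m) =
          S∖φ , Unique.filter⁺ (¬? ∘ φ?) u , m≤ , Independent-⊆ (proj₁ ∘ ∈-filter⁻ (¬? ∘ φ?)) ind ,
          λ x∈ → S⊆Y (proj₁ (∈-filter⁻ (¬? ∘ φ?) x∈)) , proj₂ (∈-filter⁻ (¬? ∘ φ?) {xs = S} x∈)
        where
        S∩φ S∖φ : List Vertex
        S∩φ = filter φ? S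
        S∖φ = filter (¬? ∘ φ?) S

        <n : length S∩φ < n
        <n = ≰⇒> λ n≤ → ¬S
          ( S∩φ , Unique.filter⁺ φ? u , n≤ , Independent-⊆ (proj₁ ∘ ∈-filter⁻ φ?) ind
          , λ x∈ → S⊆Y (proj₁ (∈-filter⁻ φ? x∈)) , proj₂ (∈-filter⁻ φ? {xs = S} x∈))

        m≤ : m ≤ length S∖φ
        m≤ = +-cancelˡ-≤ n _ _ (≤-trans n+m≤ (≤-trans (≤-reflexive (sym (length-filter-∁ φ? S)))
          (+-monoˡ-≤ _ (<⇒≤ <n))))

  -- The quantifier "almost all"

  AlmostAll : ∀ {p r} → Pred Vertex p → Pred Vertex r → Set (ℓ ⊔ p ⊔ r)
  AlmostAll Y φ = ¬ Big (Y ∩ ∁ φ)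

  module _ {p} {Y : Pred Vertex p} where

    AlmostAll-map : ∀ {r s} {φ : Pred Vertex r} {ψ : Pred Vertex s} →
      φ ⊆ ψ → AlmostAll Y φ → AlmostAll Y ψ
    AlmostAll-map φ⊆ψ ¬big big = ¬big (Big-mono (λ (y , ¬ψ) → y , λ φx → ¬ψ (φ⊆ψ φx)) big)

    AlmostAll-universal : ∀ {r} {φ : Pred Vertex r} → (∀ {x} → Y x → φ x) → AlmostAll Y φ
    AlmostAll-universal all big with x , Yx , ¬φx ← Big-∈ big = ¬φx (all Yx)

    -- Suppose the exceptions to the intersection are big. Those outside φ are not, so those inside
    -- φ are big; but they are exceptions to ψ.
    AlmostAll-∩ : ∀ {r s} {φ : Pred Vertex r} {ψ : Pred Vertex s} →
      AlmostAll Y φ → AlmostAll Y ψ → AlmostAll Y (φ ∩ ψ)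
    AlmostAll-∩ {φ = φ} aφ aψ big = aψ (Big-mono (λ ((y , ¬φψ) , φx) → y , λ ψx → ¬φψ (φx , ψx))
      (Big-partition {φ = φ} big λ big′ → aφ (Big-mono (λ ((y , _) , ¬φ) → y , ¬φ) big′)))

    AlmostAll-∈ : ∀ {b s} {B : Set b} (φ : B → Pred Vertex s) L →
      (∀ {b} → b ∈ L → AlmostAll Y (φ b)) → AlmostAll Y (λ y → ∀ {b} → b ∈ L → φ b y)
    AlmostAll-∈ φ []      aa = AlmostAll-universal λ _ ()
    AlmostAll-∈ φ (b ∷ L) aa =
      AlmostAll-map (λ { (φb , φL) (here refl) → φb ; (φb , φL) (there c∈L) → φL c∈L })
        (AlmostAll-∩ {φ = φ b} {ψ = λ y → ∀ {b} → b ∈ L → φ b y}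
          (aa (here refl)) (AlmostAll-∈ φ L (aa ∘ there)))

    AlmostAll-⊑ : ∀ {s} (φ : List Vertex → Pred Vertex s) F →
      (∀ {xs} → xs ⊑ F → AlmostAll Y (φ xs)) → AlmostAll Y (λ y → ∀ {xs} → xs ⊑ F → φ xs y)
    AlmostAll-⊑ φ []      aa = AlmostAll-map (λ { φ[] [] → φ[] }) (aa [])
    AlmostAll-⊑ φ (x ∷ F) aa =
      AlmostAll-map (λ { (φF , φxF) (_ ∷ʳ τ) → φF τ ; (φF , φxF) (refl ∷ τ) → φxF τ })
        (AlmostAll-∩ {φ = λ y → ∀ {xs} → xs ⊑ F → φ xs y} {ψ = λ y → ∀ {xs} → xs ⊑ F → φ (x ∷ xs) y}
          (AlmostAll-⊑ φ F (aa ∘ (x ∷ʳ_))) (AlmostAll-⊑ (φ ∘ (x ∷_)) F (aa ∘ (refl ∷_))))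

    AlmostAll-∉ : ∀ F → AlmostAll Y (_∉ F)
    AlmostAll-∉ F big = ¬Big-finite F (Big-mono (λ (_ , ¬∉) → decidable-stable em ¬∉) big)

  AlmostAll-antitone : ∀ {p p′ r} {Y : Pred Vertex p} {Z : Pred Vertex p′} {φ : Pred Vertex r} →
    Z ⊆ Y → AlmostAll Y φ → AlmostAll Z φ
  AlmostAll-antitone Z⊆Y ¬big big = ¬big (Big-mono (λ (z , ¬φ) → Z⊆Y z , ¬φ) big)

  -- Deciding tuples on a big set

  module _ (S : List Vertex → Pred Vertex ℓ) where

    -- Each tuple splits the current big set in two, and one half is big again. Shrinking to it
    -- preserves the decisions already made.
    decide : ∀ L {Z : Pred Vertex ℓ} → Big Z →
      ∃ λ (W : Pred Vertex ℓ) → W ⊆ Z × Big W × (∀ {xs} → xs ∈ L → W ⊆ S xs ⊎ W ⊆ ∁ (S xs))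
    decide []       {Z} big = Z , id , big , λ ()
    decide (xs ∷ L)     big with decide L big
    ... | W , W⊆Z , W-big , decided with em {P = Big (W ∩ ∁ (S xs))}
    ... | yes ∁-big = W ∩ ∁ (S xs) , W⊆Z ∘ proj₁ , ∁-big , λ where
            (here refl) → inj₂ proj₂
            (there ∈L)  → Sum.map (λ W⊆ (w , _) → W⊆ w) (λ W⊆ (w , _) → W⊆ w) (decided ∈L)
    ... | no ¬∁-big = W ∩ S xs , W⊆Z ∘ proj₁ , Big-partition W-big ¬∁-big , λ where
            (here refl) → inj₁ proj₂
            (there ∈L)  → Sum.map (λ W⊆ (w , _) → W⊆ w) (λ W⊆ (w , _) → W⊆ w) (decided ∈L)

    -- Each stage adds a block of independent vertices to the chosen ones and shrinks
    -- the reservoir until it decides all tuples chosen so far. The union of the blocks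
    -- is then big, and inside the reservoir of any stage up to finitely many vertices.
    module Stages (Y : Pred Vertex ℓ) (Y-big : Big Y) (j : ℕ) where

      record Stage : Set (lsuc ℓ) where
        field
          chosen        : List Vertex
          reservoir     : Pred Vertex ℓ
          chosen⊆Y      : (_∈ chosen) ⊆ Y
          reservoir⊆Y   : reservoir ⊆ Y
          reservoir-big : Big reservoir
      open Stage

      block : ℕ → Stage → List Vertex
      block n s = proj₁ (reservoir-big s n)

      block⊆reservoir : ∀ n s → (_∈ block n s) ⊆ reservoir s
      block⊆reservoir n s = proj₂ (proj₂ (proj₂ (proj₂ (reservoir-big s n))))

      module _ (n : ℕ) (s : Stage) where

        enlarged : List Vertex
        enlarged = block n s ++ chosen s

        decision = decide (transversals (replicate j enlarged)) (reservoir-big s)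

        next : Stage
        next = record
          { chosen        = enlarged
          ; reservoir     = proj₁ decision
          ; chosen⊆Y      = λ x∈ →
              [ reservoir⊆Y s ∘ block⊆reservoir n s , chosen⊆Y s ]′ (∈-++⁻ (block n s) x∈)
          ; reservoir⊆Y   = reservoir⊆Y s ∘ proj₁ (proj₂ decision)
          ; reservoir-big = proj₁ (proj₂ (proj₂ decision))
          }

      stage : ℕ → Stage
      stage zero    = record
        { chosen = [] ; reservoir = Y ; chosen⊆Y = λ () ; reservoir⊆Y = id ; reservoir-big = Y-big }
      stage (suc n) = next n (stage n)

      F : ℕ → List Vertex
      F = chosen ∘ stage

      F-step : ∀ n → (_∈ F n) ⊆ (_∈ F (suc n))
      F-step n = ∈-++⁺ʳ (block n (stage n))

      F-tail : ∀ {n m} → n ≤′ m →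
        (_∈ F m) ⊆ ((_∈ F n) ∪ reservoir (stage n)) × reservoir (stage m) ⊆ reservoir (stage n)
      F-tail ≤′-refl = inj₁ , id
      F-tail (≤′-step {m} n≤m) with F⊆ , res⊆ ← F-tail n≤m =
        (λ x∈ → [ inj₂ ∘ res⊆ ∘ block⊆reservoir m (stage m) , F⊆ ]′ (∈-++⁻ (block m (stage m)) x∈)) ,
        res⊆ ∘ proj₁ (proj₂ (decision m (stage m)))

      -- Built from finite lists, this stays at level `v` although the reservoirs live at level `ℓ`,
      -- so the construction can be iterated.
      Limit : Pred Vertex v
      Limit x = ∃ λ n → x ∈ F n

      Limit⊆Y : Limit ⊆ Y
      Limit⊆Y (n , x∈) = chosen⊆Y (stage n) x∈

      Limit-tail : ∀ n → Limit ⊆ ((_∈ F n) ∪ reservoir (stage n))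
      Limit-tail n (m , x∈) with ≤-total m n
      ... | inj₁ m≤n = inj₁ (ascending F F-step m≤n x∈)
      ... | inj₂ n≤m = proj₁ (F-tail (≤⇒≤′ n≤m)) x∈

      Limit-big : Big Limit
      -- The block added at stage n has at least n vertices and lies in the limit.
      Limit-big n with B , u , n≤ , ind , _ ← reservoir-big (stage n) n in eq =
        B , u , n≤ , ind , λ x∈ → suc n , ∈-++⁺ˡ (subst (λ b → _ ∈ proj₁ b) (sym eq) x∈)

      -- Some stage n has chosen all of xs, so the reservoir of stage n + 1 decides xs. The limit
      -- lies in that reservoir up to the finite set `F (suc n)`, which is not big.
      Limit-decides : ∀ {xs} → length xs ≡ j → All Limit xs →
        AlmostAll Limit (S xs) ⊎ AlmostAll Limit (∁ (S xs))
      Limit-decides {xs} refl xs⊆ with n , xs⊆Fn ← ascending-All F F-step xs⊆ =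
        Sum.map almost almost
          (proj₂ (proj₂ (proj₂ (decision n (stage n))))
            (∈-transversals-replicate (All.map (F-step n) xs⊆Fn)))
        where
        almost : {φ : Pred Vertex ℓ} → reservoir (stage (suc n)) ⊆ φ → AlmostAll Limit φ
        almost res⊆φ big = ¬Big-finite (F (suc n))
          (Big-mono (λ (x∈ , ¬φ) → [ id , (λ r → ⊥-elim (¬φ (res⊆φ r))) ]′ (Limit-tail (suc n) x∈)) big)

  -- Iterated quantifiers and their dichotomy

  Edge↑ : Pred (List Vertex) ℓ
  Edge↑ xs = Lift v (Edge xs)

  -- The tuple grows at its head: the vertex quantified innermost comes first.
  Generic : Pred Vertex v → Pred (List Vertex) ℓ → ℕ → Pred (List Vertex) ℓ
  Generic Y R zero    xs = R xs
  Generic Y R (suc k) xs = AlmostAll Y λ y → Generic Y R k (y ∷ xs)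

  Generic-antitone : ∀ {Y Z R} k {xs} → Z ⊆ Y → Generic Y R k xs → Generic Z R k xs
  Generic-antitone zero    Z⊆Y r = r
  Generic-antitone (suc k) Z⊆Y g =
    AlmostAll-antitone Z⊆Y (AlmostAll-map (Generic-antitone k Z⊆Y) g)

  -- Induction on the number k of quantifiers. The recursive call, for tuples one longer, settles
  -- all `y ∷ xs` on a set Y; a limit inside Y then settles, for each xs, which case almost all y
  -- fall under.
  Generic-dichotomy : ∀ R k j {Y : Pred Vertex v} → Big Y →
    ∃ λ (Z : Pred Vertex v) → Z ⊆ Y × Big Z ×
      (∀ {xs} → length xs ≡ j → All Z xs → Generic Z R k xs ⊎ Generic Z (∁ R) k xs)
  Generic-dichotomy R zero    j {Y} big = Y , id , big , λ {xs} _ _ → dichotomy xs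
    where
    dichotomy : ∀ xs → R xs ⊎ ¬ R xs
    dichotomy xs with em {P = R xs}
    ... | yes r = inj₁ r
    ... | no ¬r = inj₂ ¬r
  Generic-dichotomy R (suc k) j big with Y , Y⊆ , Y-big , dich ← Generic-dichotomy R k (suc j) big =
      Limit , (λ z → Y⊆ (Limit⊆Y′ z)) , Limit-big , λ {xs} len xs⊆ → Sum.map
        (λ aa → AlmostAll-map (Generic-antitone k Limit⊆Y′) aa)
        -- Failure of `Generic` for R does not by itself give `Generic` for its complement; the
        -- inductive dichotomy on Y closes this gap.
        (λ aa big′ → aa (Big-mono (λ (l , ¬g) → l , λ ¬g′ → ¬g
          ([ (λ g′ → ⊥-elim (¬g′ g′)) , Generic-antitone k Limit⊆Y′ ]′
            (dich (cong suc len) (Limit⊆Y′ l ∷ All.map Limit⊆Y′ xs⊆)))) big′))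
        (Limit-decides len xs⊆)
    where
    open Stages (λ xs x → Generic Y R k (x ∷ xs)) (λ x → Lift ℓ (Y x)) (Big-mono lift Y-big) j

    Limit⊆Y′ : Limit ⊆ Y
    Limit⊆Y′ z = lower (Limit⊆Y z)

  -- Greedy construction of chains and parts

  record Part (t : ℕ) (A : List Vertex) : Set ℓ where
    field
      size        : length A ≡ t
      independent : Independent H (_∈ A)

  module _ {Y : Pred Vertex v} (Y-big : Big Y) where

    -- The greedy invariant: the empty tuple gives the hypothesis, tuples of length q give R itself.
    -- Sublists list the newest vertex first, as `Generic` does.
    Homogeneous : Pred (List Vertex) ℓ → List Vertex → Set ℓ
    Homogeneous R F = ∀ {xs} → xs ⊑ F → length xs ≤ q → Generic Y R (q ∸ length xs) xs

    record Chain (R : Pred (List Vertex) ℓ) : Set ℓ where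
      field
        members     : List Vertex
        unique      : Unique members
        homogeneous : Homogeneous R members
    open Chain

    Extends : Pred (List Vertex) ℓ → List Vertex → Pred Vertex ℓ
    Extends R xs y = length xs < q → Generic Y R (q ∸ suc (length xs)) (y ∷ xs)

    AlmostAll-Extends : ∀ {R F xs} → Homogeneous R F → xs ⊑ F → AlmostAll Y (Extends R xs)
    AlmostAll-Extends {R} {F} {xs} hom τ with length xs <? q
    ... | no ≮q = AlmostAll-universal λ _ <q → ⊥-elim (≮q <q)
    ... | yes <q = AlmostAll-map (λ g _ → g)
      -- Below length q the number of remaining quantifiers is a successor, so the invariant
      -- quantifies over the next vertex.
      (subst (λ k → Generic Y R k xs) (+-∸-assoc 1 <q) (hom τ (<⇒≤ <q)))

    -- Almost all y lie outside F, and almost all y extend any given one of the finitely many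
    -- sublists. The common solutions form a big, hence nonempty, set.
    extend : ∀ {R} F → Homogeneous R F → ∃ λ y → y ∉ F × Homogeneous R (y ∷ F)
    extend {R} F hom
      with y , _ , y∉F , gen ← Big-∈ (Big-partition Y-big
             (AlmostAll-∩ (AlmostAll-∉ F) (AlmostAll-⊑ (Extends R) F (AlmostAll-Extends hom)))) =
        y , y∉F , λ { (_ ∷ʳ τ) → hom τ ; (refl ∷ τ) → gen τ }

    chain : ∀ {R} → Generic Y R q [] → ℕ → Chain R
    chain gen zero    = record { members = [] ; unique = [] ; homogeneous = λ { [] _ → gen } }
    chain gen (suc n) = record
      { members     = proj₁ ext ∷ members (chain gen n)
      ; unique      = ¬Any⇒All¬ _ (proj₁ (proj₂ ext)) ∷ unique (chain gen n)
      ; homogeneous = proj₂ (proj₂ ext)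
      }
      where
      ext = extend (members (chain gen n)) (homogeneous (chain gen n))

    length-chain : ∀ {R} (gen : Generic Y R q []) n → length (members (chain gen n)) ≡ n
    length-chain gen zero    = refl
    length-chain gen (suc n) = cong suc (length-chain gen n)

    infinite-independent : Generic Y (∁ Edge↑) q [] → HasInfiniteIndependentSet H
    infinite-independent gen = I , infinite , independent
      where
      F : ℕ → List Vertex
      F = members ∘ chain gen

      I : Pred Vertex v
      I x = ∃ λ n → x ∈ F n

      infinite : Infinite I
      infinite (xs , I⊆xs) = <⇒≱ (≤-reflexive (sym (length-chain gen (suc (length xs)))))
        (Unique⇒length≤ em (unique (chain gen (suc (length xs)))) λ x∈ → I⊆xs (suc (length xs) , x∈))

      independent : Independent H I
      independent {xs} edge xs⊆I with n , xs⊆F ← ascending-All F (λ _ → there) xs⊆I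
                                 with ys , ys⊑F , xs↭ys ← reorder em (F n) (edge-unique edge)
                                        (All.lookup xs⊆F) =
          -- At full length q no quantifier is left, so homogeneity says that ys is not an edge.
          subst (λ k → Generic Y (∁ Edge↑) k ys) (trans (cong (q ∸_) |ys|≡q) (n∸n≡0 q))
            (homogeneous (chain gen n) ys⊑F (≤-reflexive |ys|≡q)) (lift edge′)
        where
        edge′ : Edge ys
        edge′ = edge-resp-↭ xs↭ys edge

        |ys|≡q : length ys ≡ q
        |ys|≡q = edge-size edge′

    -- Here m counts the parts still to be added. The y outside the earlier parts that extend all of
    -- the finitely many transversals form a big set, so they contain an independent set with at
    -- least t vertices, cut down to exactly t.
    parts : ∀ t {R} m Ps → All (Part t) Ps → Unique (concat Ps) →
      (∀ {xs} → xs ∈ transversals Ps → Generic Y R m xs) →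
      ∃ λ Ps′ → length Ps′ ≡ m + length Ps × All (Part t) Ps′ × Unique (concat Ps′) ×
                All R (transversals Ps′)
    parts t zero    Ps Ps-parts u gen = Ps , refl , Ps-parts , u , All.tabulate gen
    parts t {R} (suc m) Ps Ps-parts u gen
      with A , A-unique , t≤ , ind , A⊆ ← Big-partition Y-big
             (AlmostAll-∩ (AlmostAll-∉ (concat Ps))
                          (AlmostAll-∈ (λ xs y → Generic Y R m (y ∷ xs)) (transversals Ps) gen)) t
      with Ps′ , len , rest ← parts t {R} m (take t A ∷ Ps)
             (record { size = ≤-length-take t≤ ; independent = Independent-⊆ (∈-take⁻ t) ind } ∷ Ps-parts)
             (Unique.++⁺ (Unique.take⁺ t A-unique) u λ (x∈A , x∈Ps) →
               proj₁ (proj₂ (A⊆ (∈-take⁻ t x∈A))) x∈Ps)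
             (λ xs∈ →
               let a , as , a∈ , as∈ , eq = ∈-cartesianProductWith⁻ _∷_ (take t A) (transversals Ps) xs∈ in
               subst (Generic Y R m) (sym eq) (proj₂ (proj₂ (A⊆ (∈-take⁻ t a∈))) as∈))
      = Ps′ , trans len (+-suc m (length Ps)) , rest

  -- Cliques and edges across independent parts

  -- If K met A in q or more vertices, q of them would form an edge inside the independent set A.
  -- The rest of K is a clique in the remaining parts.
  clique-bound : ∀ {t} Ps → All (Part t) Ps → ∀ K → Unique K → (_∈ K) ⊆ (_∈ concat Ps) →
    Clique H (_∈ K) → length K ≤ length Ps * q
  clique-bound []       []               K u K⊆ clique = Unique⇒length≤ em u K⊆
  clique-bound (A ∷ Ps) (A-part ∷ parts) K u K⊆ clique = begin
    length K                      ≡⟨ length-filter-∁ A? K ⟨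
    length K∩A + length K∖A       ≤⟨ +-mono-≤ (<⇒≤ <q) K∖A≤ ⟩
    q + length Ps * q             ∎
    where
    open ≤-Reasoning

    A? : Decidable (_∈ A)
    A? _ = em

    K∩A K∖A : List Vertex
    K∩A = filter A? K
    K∖A = filter (¬? ∘ A?) K

    K∖A-unique : Unique K∖A
    K∖A-unique = Unique.filter⁺ (¬? ∘ A?) u

    K∖A⊆ : (_∈ K∖A) ⊆ (_∈ concat Ps)
    K∖A⊆ x∈ with x∈K , x∉A ← ∈-filter⁻ (¬? ∘ A?) {xs = K} x∈ =
      [ (λ x∈A → ⊥-elim (x∉A x∈A)) , id ]′ (∈-++⁻ A (K⊆ x∈K))

    K∖A-clique : Clique H (_∈ K∖A)
    K∖A-clique u len xs⊆ = clique u len (All.map (proj₁ ∘ ∈-filter⁻ (¬? ∘ A?)) xs⊆)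

    K∖A≤ : length K∖A ≤ length Ps * q
    K∖A≤ = clique-bound Ps parts K∖A K∖A-unique K∖A⊆ K∖A-clique

    <q : length K∩A < q
    <q = ≰⇒> λ q≤ → Part.independent A-part
      (clique (Unique.take⁺ q (Unique.filter⁺ A? u)) (≤-length-take q≤)
        (All.tabulate (proj₁ ∘ ∈-filter⁻ A? ∘ ∈-take⁻ q)))
      (All.tabulate (λ x∈ → proj₂ (∈-filter⁻ A? {xs = K} (∈-take⁻ q x∈))))

  edgeCount-parts : ∀ {t} Ps → All (Part t) Ps → length Ps ≡ q → All Edge (transversals Ps) →
    t ^ q ≤ edgeCount H (λ _ → em) (concat Ps)
  edgeCount-parts {t} Ps parts |Ps|≡q edges = begin
    t ^ q                                     ≡⟨ cong (t ^_) |Ps|≡q ⟨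
    t ^ length Ps                             ≡⟨ length-transversals (All.map Part.size parts) ⟨
    length (transversals Ps)                  ≡⟨ cong length (filter-all edge? edges) ⟨
    length (filter edge? (transversals Ps))   ≤⟨ Sub.length-mono-≤ (Sub.filter⁺ edge? edge? (λ { refl → id }) ⊑choose) ⟩
    edgeCount H edge? (concat Ps)             ∎
    where
    open ≤-Reasoning

    ⊑choose : transversals Ps ⊑ choose q (concat Ps)
    ⊑choose = subst (λ k → transversals Ps ⊑ choose k (concat Ps)) |Ps|≡q (transversals⊑choose Ps)

    edge? : Decidable Edge
    edge? _ = em

-- Binomial and rational estimates

^-distribʳ-* : ∀ m n k → (m * n) ^ k ≡ m ^ k * n ^ k
^-distribʳ-* m n zero    = refl
^-distribʳ-* m n (suc k) =
  trans (cong (m * n *_) (^-distribʳ-* m n k)) ([m*n]*[o*p]≡[m*o]*[n*p] m n (m ^ k) (n ^ k))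

nCk≤n^k : ∀ n k → n C k ≤ n ^ k
nCk≤n^k n       zero    = ≤-refl
nCk≤n^k zero    (suc k) = ≤-reflexive (k>n⇒nCk≡0 {0} {suc k} (s≤s z≤n))
nCk≤n^k (suc n) (suc k) = begin
  suc n C suc k        ≡⟨ nCk+nC[k+1]≡[n+1]C[k+1] n k ⟨
  n C k + n C suc k    ≤⟨ +-mono-≤ (nCk≤n^k n k) (nCk≤n^k n (suc k)) ⟩
  -- By definition this is `suc n * n ^ k`.
  n ^ k + n * n ^ k    ≤⟨ *-monoʳ-≤ (suc n) (^-monoˡ-≤ k (n≤1+n n)) ⟩
  suc n ^ suc k        ∎
  where open ≤-Reasoning

module _ (p d : ℕ) .(c : Coprime p (suc d)) (n k : ℕ) where

  private
    homo : toℚᵘ (mkℚ (ℤ.+ p) d c ℚ.* fromℤ (ℤ.+ n)) ℚᵘ.≃ mkℚᵘ (ℤ.+ p) d ℚᵘ.* mkℚᵘ (ℤ.+ n) 0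
    homo = ℚₚ.toℚᵘ-homo-* (mkℚ (ℤ.+ p) d c) (fromℤ (ℤ.+ n))

    lhs : (ℤ.+ p ℤ.* ℤ.+ n) ℤ.* ℤ.1ℤ ≡ ℤ.+ (p * n)
    lhs = trans (ℤₚ.*-identityʳ _) (sym (ℤₚ.pos-* p n))

    rhs : ℤ.+ k ℤ.* ℤ.+ (suc d * 1) ≡ ℤ.+ (k * suc d)
    rhs = trans (sym (ℤₚ.pos-* k (suc d * 1))) (cong (λ m → ℤ.+ (k * m)) (*-identityʳ (suc d)))

  -- Cross-multiplication; with its converse below, it moves the Helly inequalities to natural
  -- numbers.
  fraction-*-≤⁺ : p * n ≤ k * suc d → mkℚ (ℤ.+ p) d c ℚ.* fromℤ (ℤ.+ n) ℚ.≤ fromℤ (ℤ.+ k)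
  fraction-*-≤⁺ le = ℚₚ.toℚᵘ-cancel-≤ (ℚᵘₚ.≤-respˡ-≃ (ℚᵘₚ.≃-sym homo)
    (*≤* (subst₂ ℤ._≤_ (sym lhs) (sym rhs) (ℤ.+≤+ le))))

  fraction-*-≤⁻ : mkℚ (ℤ.+ p) d c ℚ.* fromℤ (ℤ.+ n) ℚ.≤ fromℤ (ℤ.+ k) → p * n ≤ k * suc d
  fraction-*-≤⁻ le = ℤₚ.drop‿+≤+ (subst₂ ℤ._≤_ lhs rhs
    (ℚᵘₚ.drop-*≤* (ℚᵘₚ.≤-respˡ-≃ homo (ℚₚ.toℚᵘ-mono-≤ le))))

theorem4 : (em : ∀ {ℓ} → ExcludedMiddle ℓ) →
    ∀ {v e} (q : ℕ) .{{_ : NonZero q}} (H : Hypergraph q v e) →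
    FractionalHelly H (λ _ → em) →
    ArbitrarilyLargeFiniteIndependentSets H →
    HasInfiniteIndependentSet H
theorem4 em {v} q H helly large =
    [ (λ edges → ⊥-elim (no-multipartite edges)) , infinite-independent Z-big ]′ (homogeneous refl [])
  where
  open Hypergraph H
  open Largeness em H

  all-big : Big {v} (λ _ → Lift v ⊤)
  all-big n with S , u , n≤ , ind ← large n = S , u , n≤ , ind , _

  -- With q quantifiers and no fixed vertices, the two cases concern the empty tuple.
  dichotomy = Generic-dichotomy Edge↑ q 0 all-big

  Z = proj₁ dichotomy
  Z-big = proj₁ (proj₂ (proj₂ dichotomy))
  homogeneous = proj₂ (proj₂ (proj₂ dichotomy))

  instance
    q^q≢0 : NonZero (q ^ q)
    q^q≢0 = m^n≢0 q q

  α : ℚ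
  -- The density is 1 / q ^ q: `mkℚ` stores the predecessor of the denominator.
  α = mkℚ (ℤ.+ 1) (pred (q ^ q)) (1-coprimeTo _)

  no-multipartite : ¬ Generic Z Edge↑ q []
  no-multipartite gen with helly α (ℚₚ.positive⁻¹ α)
  -- Positivity of β leaves only the form (p + 1) / (d + 1).
  ... | mkℚ (ℤ.+ zero) _ _ , ℚ.*<* (ℤ.+<+ ()) , _
  ... | mkℚ -[1+ _ ] _ _ , ℚ.*<* () , _
  ... | mkℚ +[1+ p ] d c , _ , large-clique
    with Ps , len , Ps-parts , u , edges ←
           -- As β is at least 1 / (d + 1), this part size exceeds q / β and forces a clique with
           -- more than q * q vertices.
           parts Z-big (suc (q * suc d)) q [] [] [] (λ { (here refl) → gen })
    = <-irrefl refl (begin-strict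
        q * (q * suc d)          <⟨ *-monoʳ-< q (n<1+n (q * suc d)) ⟩
        q * t                    ≡⟨ |S| ⟨
        length S                 ≤⟨ m≤m+n _ _ ⟩
        suc p * length S         ≤⟨ fraction-*-≤⁻ (suc p) d c _ _ ≤K ⟩
        length K * suc d         ≤⟨ *-monoˡ-≤ (suc d) (clique-bound Ps Ps-parts K K-unique K⊆ clique) ⟩
        length Ps * q * suc d    ≡⟨ cong (λ m → m * q * suc d) |Ps| ⟩
        q * q * suc d            ≡⟨ *-assoc q q (suc d) ⟩
        q * (q * suc d)          ∎)
    where
    open ≤-Reasoning
    t = suc (q * suc d)
    S = concat Ps

    |Ps| : length Ps ≡ q
    |Ps| = trans len (+-identityʳ q)

    |S| : length S ≡ q * t
    |S| = trans (length-concat (All.map Part.size Ps-parts)) (cong (_* t) |Ps|)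

    E : ℕ
    E = edgeCount H (λ _ → em) S

    t^q≤ : t ^ q ≤ E
    t^q≤ = edgeCount-parts Ps Ps-parts |Ps| (All.map lower edges)

    dense : 1 * (length S C q) ≤ E * suc (pred (q ^ q))
    dense = begin
      1 * (length S C q)                                 ≡⟨ *-identityˡ _ ⟩
      length S C q                                       ≤⟨ nCk≤n^k (length S) q ⟩
      length S ^ q                                       ≡⟨ cong (_^ q) |S| ⟩
      (q * t) ^ q                                        ≡⟨ ^-distribʳ-* q t q ⟩
      q ^ q * t ^ q                                      ≡⟨ *-comm (q ^ q) (t ^ q) ⟩
      t ^ q * q ^ q                                      ≤⟨ *-monoˡ-≤ (q ^ q) t^q≤ ⟩
      E * q ^ q                   ≡⟨ cong (E *_) (suc-pred (q ^ q)) ⟨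
      E * suc (pred (q ^ q))      ∎

    clique-in-S = large-clique S u
      (fraction-*-≤⁺ 1 (pred (q ^ q)) (1-coprimeTo (suc (pred (q ^ q)))) _ _ dense)
    K        = proj₁ clique-in-S
    K-unique = proj₁ (proj₂ clique-in-S)
    K⊆       = proj₁ (proj₂ (proj₂ clique-in-S))
    clique   = proj₁ (proj₂ (proj₂ (proj₂ clique-in-S)))
    ≤K       = proj₂ (proj₂ (proj₂ (proj₂ clique-in-S)))
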